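{- For each odd prime $p$, there exists a non-Schurian association scheme with the same intersection numbers as the Schurian scheme $(V,\mathcal{R}_G)$, where $V=\mathbb{F}_p^3$, $G$ is the group of permutations of $V$ generated by $\{\tau_y,\iota\mid y\in V\}$ with $\tau_y(x)=x+y$ and $\iota((x_1,x_2,x_3))=(x_1+x_2,\,x_2+x_3,\,x_3)$, and $\mathcal{R}_G$ is the set of orbits of the induced action of $G$ on $V\times V$.
   Context: An association scheme $(X,S)$ consists of a non-empty finite set $X$ and a partition $S$ of $X\times X$ such that: (i) $1_X:=\{(x,x)\mid x\in X\}\in S$; (ii) for each $s\in S$, $s^*:=\{(x,y)\mid (y,x)\in s\}\in S$; (iii) for all $s,t,u\in S$ the number $c_{st}^u:=|xs\cap yt^*|$ is constant whenever $(x,y)\in u$, where $xs:=\{y\in X\mid (x,y)\in s\}$. The $c_{st}^u$ are the intersection numbers. For a transitive permutation group $G$ on a finite set $\Omega$, $(\Omega,\mathcal{R}_G)$ is an association scheme, where $\mathcal{R}_G$ is the set of orbits of the induced action of $G$ on $\Omega\times\Omega$. An association scheme $(X,S)$ is Schurian if $S=\mathcal{R}_G$ for some transitive permutation group $G$ on $X$, and non-Schurian otherwise. Two association schemes $(X,S)$ and $(X_1,S_1)$ have the same intersection numbers (are algebraically isomorphic) if there is a bijection $\iota:S\to S_1$ with $c_{rs}^t=c_{r^\iota s^\iota}^{t^\iota}$ for all $r,s,t\in S$. -}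

module Defs where

open import Data.Fin.Base using (Fin; toℕ)
open import Data.Fin.Properties using (toℕ-fromℕ<; toℕ-injective; toℕ<n; toℕ≤n)
open import Data.List.Base using (length; filter; map; allFin)
open import Data.Nat.Base using (ℕ; NonZero; _+_; _∸_; _%_)
open import Data.Nat.DivMod
  using (_mod_; m%n<n; m<n⇒m%n≡m; [m+n]%n≡m%n; %-distribˡ-+)
open import Data.Nat.Properties using (+-assoc; m+[n∸m]≡n; m∸n+n≡m)
open import Data.Product.Base using (Σ; ∃; ∃₂; _×_; _,_)
open import Function.Bundles using (Inverse; _↔_; mk↔ₛ′; _⇔_)
open import Function.Properties.Inverse using (↔-refl; ↔-sym; ↔-trans)
open import Level using (0ℓ)
open import Relation.Binary.Definitions using (DecidableEquality)
open import Relation.Binary.PropositionalEquality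
  using (_≡_; _≗_; refl; trans; cong; cong₂; module ≡-Reasoning)
open import Relation.Nullary.Decidable using (_×-dec_)
open import Relation.Unary using (Pred; Decidable; _∈_)

open Inverse using (to)

-- The partition of X × X is given by the map `rel` sending a pair to (the
-- label of) the unique block containing it: the block labelled s is
-- { (x , y) ∣ rel x y ≡ s }.  Surjectivity says that blocks are non-empty,
-- so labels correspond bijectively to blocks (and S is finite).
record AssociationScheme (X : Set) : Set₁ where
  field
    size   : ℕ
    enum   : Fin size ↔ X
    point  : X

    S              : Set
    _≟_            : DecidableEquality S
    rel            : X → X → S
    rel-surjective : ∀ s → ∃₂ λ x y → rel x y ≡ s

    1ₓ     : S
    rel-1ₓ : ∀ x y → rel x y ≡ 1ₓ ⇔ x ≡ y

    _*     : S → S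
    rel-*  : ∀ s x y → rel x y ≡ s * ⇔ rel y x ≡ s

  ∣_∣ : {P : Pred X 0ℓ} → Decidable P → ℕ
  ∣ P? ∣ = length (filter P? (map (to enum) (allFin size)))

  -- z ∈ xs ∩ yt*, where xs = { z ∣ (x , z) ∈ s }.
  meet? : ∀ x s y t → Decidable (λ z → rel x z ≡ s × rel y z ≡ t *)
  meet? x s y t z = (rel x z ≟ s) ×-dec (rel y z ≟ (t *))

  field
    c   : S → S → S → ℕ
    c-≡ : ∀ s t u x y → rel x y ≡ u → ∣ meet? x s y t ∣ ≡ c s t u

record SameIntersectionNumbers {X Y : Set}
         (𝒮 : AssociationScheme X) (𝒯 : AssociationScheme Y) : Set where
  private
    module 𝒮 = AssociationScheme 𝒮
    module 𝒯 = AssociationScheme 𝒯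
  field
    bij : 𝒮.S ↔ 𝒯.S
    c-≡ : ∀ r s t → 𝒮.c r s t ≡ 𝒯.c (to bij r) (to bij s) (to bij t)

-- `resp` makes membership depend only on the underlying function.
record PermutationGroup (X : Set) : Set₁ where
  field
    Member : Pred (X ↔ X) 0ℓ
    resp   : ∀ {g h} → to g ≗ to h → g ∈ Member → h ∈ Member
    id∈    : ↔-refl ∈ Member
    ∘∈     : ∀ {g h} → g ∈ Member → h ∈ Member → ↔-trans g h ∈ Member
    inv∈   : ∀ {g} → g ∈ Member → ↔-sym g ∈ Member

open PermutationGroup using (Member)

data Closure {X : Set} (A : Pred (X ↔ X) 0ℓ) : Pred (X ↔ X) 0ℓ where
  gen  : ∀ {g} → g ∈ A → g ∈ Closure A
  resp : ∀ {g h} → to g ≗ to h → g ∈ Closure A → h ∈ Closure A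
  id∈  : ↔-refl ∈ Closure A
  ∘∈   : ∀ {g h} → g ∈ Closure A → h ∈ Closure A → ↔-trans g h ∈ Closure A
  inv∈ : ∀ {g} → g ∈ Closure A → ↔-sym g ∈ Closure A

⟨_⟩ : {X : Set} → Pred (X ↔ X) 0ℓ → PermutationGroup X
⟨ A ⟩ = record
  { Member = Closure A ; resp = resp ; id∈ = id∈ ; ∘∈ = ∘∈ ; inv∈ = inv∈ }

Transitive : {X : Set} → PermutationGroup X → Set
Transitive G = ∀ x y → ∃ λ g → g ∈ Member G × to g x ≡ y

SameOrbital : {X : Set} → PermutationGroup X → X × X → X × X → Set
SameOrbital G (x , y) (x′ , y′) =
  ∃ λ g → g ∈ Member G × to g x ≡ x′ × to g y ≡ y′

-- The partition of X × X is the set of orbits of G: two pairs lie in the same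
-- block exactly when they lie in the same orbit.
_≡ℛ_ : {X : Set} → AssociationScheme X → PermutationGroup X → Set
𝒮 ≡ℛ G = ∀ x y x′ y′ →
  rel x y ≡ rel x′ y′ ⇔ SameOrbital G (x , y) (x′ , y′)
  where open AssociationScheme 𝒮

Schurian : {X : Set} → AssociationScheme X → Set₁
Schurian {X} 𝒮 = Σ (PermutationGroup X) λ G → Transitive G × 𝒮 ≡ℛ G

module _ (p : ℕ) .{{_ : NonZero p}} where

  infixl 6 _⊕_ _⊖_

  -- The summand p ∸ toℕ b keeps ⊖ clear of truncated subtraction.
  _⊕_ _⊖_ : Fin p → Fin p → Fin p
  a ⊕ b = (toℕ a + toℕ b) mod p
  a ⊖ b = (toℕ a + (p ∸ toℕ b)) mod p

  private
    toℕ-mod : ∀ m → toℕ (m mod p) ≡ m % p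
    toℕ-mod m = toℕ-fromℕ< (m%n<n m p)

    toℕ-% : ∀ (a : Fin p) → toℕ a % p ≡ toℕ a
    toℕ-% a = m<n⇒m%n≡m (toℕ<n a)

    cancel : ∀ (a : Fin p) m n → m + n ≡ p →
             (toℕ ((toℕ a + m) mod p) + n) mod p ≡ a
    cancel a m n m+n≡p = toℕ-injective (begin
      toℕ ((toℕ ((toℕ a + m) mod p) + n) mod p)  ≡⟨ toℕ-mod _ ⟩
      (toℕ ((toℕ a + m) mod p) + n) % p          ≡⟨ %-distribˡ-+ _ n p ⟩
      (toℕ ((toℕ a + m) mod p) % p + n % p) % p
        ≡⟨ cong (λ k → (k + n % p) % p) (trans (toℕ-% _) (toℕ-mod _)) ⟩
      ((toℕ a + m) % p + n % p) % p              ≡⟨ %-distribˡ-+ (toℕ a + m) n p ⟨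
      (toℕ a + m + n) % p
        ≡⟨ cong (_% p) (trans (+-assoc (toℕ a) m n) (cong (toℕ a +_) m+n≡p)) ⟩
      (toℕ a + p) % p                            ≡⟨ [m+n]%n≡m%n (toℕ a) p ⟩
      toℕ a % p                                  ≡⟨ toℕ-% a ⟩
      toℕ a                                      ∎)
      where open ≡-Reasoning

  ⊕-⊖ : ∀ a b → a ⊕ b ⊖ b ≡ a
  ⊕-⊖ a b = cancel a (toℕ b) (p ∸ toℕ b) (m+[n∸m]≡n (toℕ≤n b))

  ⊖-⊕ : ∀ a b → a ⊖ b ⊕ b ≡ a
  ⊖-⊕ a b = cancel a (p ∸ toℕ b) (toℕ b) (m∸n+n≡m (toℕ≤n b))

  V : Set
  V = Fin p × Fin p × Fin p

  τ : V → V ↔ V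
  τ (y₁ , y₂ , y₃) = mk↔ₛ′
    (λ (x₁ , x₂ , x₃) → x₁ ⊕ y₁ , x₂ ⊕ y₂ , x₃ ⊕ y₃)
    (λ (x₁ , x₂ , x₃) → x₁ ⊖ y₁ , x₂ ⊖ y₂ , x₃ ⊖ y₃)
    (λ (x₁ , x₂ , x₃) →
      cong₂ _,_ (⊖-⊕ x₁ y₁) (cong₂ _,_ (⊖-⊕ x₂ y₂) (⊖-⊕ x₃ y₃)))
    (λ (x₁ , x₂ , x₃) →
      cong₂ _,_ (⊕-⊖ x₁ y₁) (cong₂ _,_ (⊕-⊖ x₂ y₂) (⊕-⊖ x₃ y₃)))

  ι : V ↔ V
  ι = mk↔ₛ′
    (λ (x₁ , x₂ , x₃) → x₁ ⊕ x₂ , x₂ ⊕ x₃ , x₃)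
    (λ (x₁ , x₂ , x₃) → x₁ ⊖ (x₂ ⊖ x₃) , x₂ ⊖ x₃ , x₃)
    (λ (x₁ , x₂ , x₃) →
      cong₂ _,_ (⊖-⊕ x₁ (x₂ ⊖ x₃)) (cong₂ _,_ (⊖-⊕ x₂ x₃) refl))
    (λ (x₁ , x₂ , x₃) →
      cong₂ _,_ (trans (cong (x₁ ⊕ x₂ ⊖_) (⊕-⊖ x₂ x₃)) (⊕-⊖ x₁ x₂))
                (cong₂ _,_ (⊕-⊖ x₂ x₃) refl))

  data Generator : Pred (V ↔ V) 0ℓ where
    τ∈ : ∀ y → τ y ∈ Generator
    ι∈ : ι ∈ Generator

  G : PermutationGroup V
  G = ⟨ Generator ⟩

{-# OPTIONS --safe #-}

-- Write Q(a, b, c) = b² − 2ac − bc.  The orbit of (x, y) under G is determined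
-- by d = y − x = (a, b, c): by c and Q(d) if c ≠ 0, by b if c = 0 ≠ b, and by a
-- otherwise.  The involution σ(a, b, c) = (a + b, − b, c) preserves Q, so it
-- only exchanges the labels b and − b of pairs inside a fibre of the third
-- coordinate.  The non-Schurian scheme has this exchange made inside the single
-- fibre x₃ = 0.
--
-- To see that its intersection numbers are unchanged, fix x, y and let z vary.
-- If x and y lie in one fibre, apply σ to all points z at once.  If not, a power
-- of ι makes d₂ = 0, hence σ d = d, and one can reflect just the z in the fibre
-- of x or of y, because labels between different fibres do not notice it.
--
-- It is not Schurian: for u, u′ in one fibre and v, v′ in another the mixed
-- second difference of Q is − 2 (u′₂ − u₂)(v′₂ − v₂), so an automorphism
-- preserves the product of the two differences.  But one taking the fibres 0, 1
-- to the fibres 1, 2 negates only the first factor.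
module Submission where

open import Defs
open import Data.Nat.Base using (ℕ; NonZero)
open import Data.Nat.Divisibility using (_∤_)
open import Data.Nat.Primality using (Prime)
open import Data.Product.Base using (Σ; _×_)
open import Relation.Nullary.Negation using (¬_)

open import Algebra.Bundles using (CommutativeRing; RawRing)
import Algebra.Properties.AbelianGroup as AbelianGroupProperties
import Algebra.Properties.Ring as RingProperties
import Algebra.Solver.Ring as RingSolver
open import Algebra.Solver.Ring.AlmostCommutativeRing
  using (fromCommutativeRing; _-Raw-AlmostCommutative⟶_)
import Algebra.Solver.Ring.NaturalCoefficients.Default as SemiringSolver
open import Data.Fin.Base using (Fin; toℕ)
import Data.Fin.Properties as Fin
open import Data.List.Base using (List; length; filter; map; allFin)
import Data.List.Membership.Propositional as List
open import Data.List.Membership.Propositional.Properties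
  using (∈-map⁺; ∈-map⁻; ∈-filter⁺; ∈-filter⁻; ∈-allFin)
open import Data.List.Membership.Propositional.Properties.WithK using (unique∧set⇒bag)
open import Data.List.Properties using (length-map)
open import Data.List.Relation.Binary.BagAndSetEquality using (∼bag⇒↭)
open import Data.List.Relation.Binary.Permutation.Propositional.Properties using (↭-length)
open import Data.List.Relation.Unary.Unique.Propositional using (Unique)
import Data.List.Relation.Unary.Unique.Propositional.Properties as Unique
open import Data.Maybe.Base using (Maybe)
import Data.Maybe.Base as Maybe
import Data.Nat.Base as ℕ
open import Data.Nat.Coprimality using (prime⇒coprime; coprime-Bézout)
import Data.Nat.Divisibility as ℕ
open import Data.Nat.DivMod
  using (_%_; _mod_; m%n<n; m<n⇒m%n≡m; %-distribˡ-+; %-distribˡ-*; m*n%n≡0)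
open import Data.Nat.GCD using (module Bézout)
open import Data.Nat.Primality using (prime⇒nonTrivial)
import Data.Nat.Properties as ℕ
open import Data.Product.Base using (∃; _,_; proj₁; proj₂)
open import Data.Product.Function.NonDependent.Propositional using (_×-↔_)
open import Data.Sign.Base using (Sign) renaming (+ to plus; - to minus)
open import Function.Bundles using (Inverse; _↔_; mk↔ₛ′; mk⇔; _⇔_; Equivalence)
open import Function.Properties.Inverse using (↔-refl; ↔-sym; ↔-trans)
open import Level using (0ℓ)
open import Relation.Binary.Definitions using (DecidableEquality)
open import Relation.Binary.PropositionalEquality hiding ([_])
open import Relation.Nullary.Decidable using (Dec; yes; no; _×-dec_; dec⇒maybe)
open import Relation.Nullary.Negation using (contradiction)
open import Relation.Nullary.Recomputable using (¬-recompute)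
open import Relation.Unary using (Pred; Decidable; _∈_)

open Inverse using (to; from; strictlyInverseˡ; strictlyInverseʳ)

-- Counting along bijections of a finite set.

to-injective : ∀ {X Y : Set} (π : X ↔ Y) {x y} → to π x ≡ to π y → x ≡ y
to-injective π {x} {y} eq = begin
  x                ≡⟨ strictlyInverseʳ π x ⟨
  from π (to π x)  ≡⟨ cong (from π) eq ⟩
  from π (to π y)  ≡⟨ strictlyInverseʳ π y ⟩
  y                ∎
  where open ≡-Reasoning

module _ {X : Set} {n : ℕ} (enum : Fin n ↔ X) where

  elements : List X
  elements = map (to enum) (allFin n)

  ∈-elements : ∀ x → x List.∈ elements
  ∈-elements x = subst (List._∈ elements) (strictlyInverseˡ enum x)
    (∈-map⁺ (to enum) (∈-allFin (from enum x)))

  elements-unique : Unique elements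
  elements-unique = Unique.map⁺ (to-injective enum) (Unique.allFin⁺ n)

  -- The image under `π` of the first filtered list and the second filtered list are both
  -- duplicate-free and have the same members, so they are permutations of each other.
  length-filter-↔ : {P Q : Pred X 0ℓ} (P? : Decidable P) (Q? : Decidable Q) (π : X ↔ X) →
    (∀ x → P x ⇔ Q (to π x)) → length (filter P? elements) ≡ length (filter Q? elements)
  length-filter-↔ {P} {Q} P? Q? π P⇔Q = begin
    length (filter P? elements)               ≡⟨ length-map (to π) (filter P? elements) ⟨
    length (map (to π) (filter P? elements))  ≡⟨ ↭-length (∼bag⇒↭ (unique∧set⇒bag
        (Unique.map⁺ (to-injective π) (Unique.filter⁺ P? elements-unique))
        (Unique.filter⁺ Q? elements-unique)
        (mk⇔ forward backward))) ⟩
    length (filter Q? elements)               ∎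
    where
    open ≡-Reasoning
    forward : ∀ {y} → y List.∈ map (to π) (filter P? elements) → y List.∈ filter Q? elements
    forward y∈ with x , x∈ , refl ← ∈-map⁻ (to π) y∈ =
      ∈-filter⁺ Q? (∈-elements _) (Equivalence.to (P⇔Q x) (proj₂ (∈-filter⁻ P? {xs = elements} x∈)))
    backward : ∀ {y} → y List.∈ filter Q? elements → y List.∈ map (to π) (filter P? elements)
    backward {y} y∈ = subst (List._∈ map (to π) (filter P? elements)) (strictlyInverseˡ π y)
      (∈-map⁺ (to π) (∈-filter⁺ P? (∈-elements _) (Equivalence.from (P⇔Q (from π y))
        (subst Q (sym (strictlyInverseˡ π y)) (proj₂ (∈-filter⁻ Q? {xs = elements} y∈))))))

-- Residues modulo `p` as a commutative ring, with a solver.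

m∸n+n≡m+[n∸m] : ∀ m n → m ℕ.∸ n ℕ.+ n ≡ m ℕ.+ (n ℕ.∸ m)
m∸n+n≡m+[n∸m] m         0         = cong (m ℕ.+_) (sym (ℕ.0∸n≡0 m))
m∸n+n≡m+[n∸m] 0         (ℕ.suc n) = refl
m∸n+n≡m+[n∸m] (ℕ.suc m) (ℕ.suc n) =
  trans (ℕ.+-suc (m ℕ.∸ n) n) (cong ℕ.suc (m∸n+n≡m+[n∸m] m n))

module ModularRing (p : ℕ) .{{_ : NonZero p}} where

  F : Set
  F = Fin p

  infixl 6 _+_
  infixl 7 _*_
  infix 8 -_

  [_] : ℕ → F
  [ n ] = n mod p

  _+_ _*_ : F → F → F
  _+_ = _⊕_ p
  a * b = [ toℕ a ℕ.* toℕ b ]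

  0# 1# : F
  0# = [ 0 ]
  1# = [ 1 ]

  -_ : F → F
  - a = _⊖_ p 0# a

  toℕ-[] : ∀ n → toℕ [ n ] ≡ n % p
  toℕ-[] n = Fin.toℕ-fromℕ< (m%n<n n p)

  []-cong : ∀ {m n} → m % p ≡ n % p → [ m ] ≡ [ n ]
  []-cong {m} {n} eq = Fin.toℕ-injective (trans (toℕ-[] m) (trans eq (sym (toℕ-[] n))))

  []-injective : ∀ {m n} → [ m ] ≡ [ n ] → m % p ≡ n % p
  []-injective {m} {n} eq = trans (sym (toℕ-[] m)) (trans (cong toℕ eq) (toℕ-[] n))

  []-toℕ : ∀ a → [ toℕ a ] ≡ a
  []-toℕ a = Fin.toℕ-injective (trans (toℕ-[] (toℕ a)) (m<n⇒m%n≡m (Fin.toℕ<n a)))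

  -- Matching on this result brings a residue into the form `[ n ]`, so that the ring laws below
  -- descend from the natural numbers through `[]-+` and `[]-*`.
  []-surjective : ∀ a → ∃ λ n → [ n ] ≡ a
  []-surjective a = toℕ a , []-toℕ a

  []-+ : ∀ m n → [ m ] + [ n ] ≡ [ m ℕ.+ n ]
  []-+ m n = []-cong (trans
    (cong₂ (λ i j → (i ℕ.+ j) % p) (toℕ-[] m) (toℕ-[] n)) (sym (%-distribˡ-+ m n p)))

  []-* : ∀ m n → [ m ] * [ n ] ≡ [ m ℕ.* n ]
  []-* m n = []-cong (trans
    (cong₂ (λ i j → (i ℕ.* j) % p) (toℕ-[] m) (toℕ-[] n)) (sym (%-distribˡ-* m n p)))

  +-assoc : ∀ a b c → (a + b) + c ≡ a + (b + c)
  +-assoc a b c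
    with l , refl ← []-surjective a | m , refl ← []-surjective b | n , refl ← []-surjective c
    = begin
      ([ l ] + [ m ]) + [ n ]  ≡⟨ cong (_+ [ n ]) ([]-+ l m) ⟩
      [ l ℕ.+ m ] + [ n ]      ≡⟨ []-+ (l ℕ.+ m) n ⟩
      [ l ℕ.+ m ℕ.+ n ]        ≡⟨ cong [_] (ℕ.+-assoc l m n) ⟩
      [ l ℕ.+ (m ℕ.+ n) ]      ≡⟨ []-+ l (m ℕ.+ n) ⟨
      [ l ] + [ m ℕ.+ n ]      ≡⟨ cong ([ l ] +_) ([]-+ m n) ⟨
      [ l ] + ([ m ] + [ n ])  ∎
    where open ≡-Reasoning

  *-assoc : ∀ a b c → (a * b) * c ≡ a * (b * c)
  *-assoc a b c
    with l , refl ← []-surjective a | m , refl ← []-surjective b | n , refl ← []-surjective c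
    = begin
      ([ l ] * [ m ]) * [ n ]  ≡⟨ cong (_* [ n ]) ([]-* l m) ⟩
      [ l ℕ.* m ] * [ n ]      ≡⟨ []-* (l ℕ.* m) n ⟩
      [ l ℕ.* m ℕ.* n ]        ≡⟨ cong [_] (ℕ.*-assoc l m n) ⟩
      [ l ℕ.* (m ℕ.* n) ]      ≡⟨ []-* l (m ℕ.* n) ⟨
      [ l ] * [ m ℕ.* n ]      ≡⟨ cong ([ l ] *_) ([]-* m n) ⟨
      [ l ] * ([ m ] * [ n ])  ∎
    where open ≡-Reasoning

  *-distribˡ-+ : ∀ a b c → a * (b + c) ≡ a * b + a * c
  *-distribˡ-+ a b c
    with l , refl ← []-surjective a | m , refl ← []-surjective b | n , refl ← []-surjective c
    = begin
      [ l ] * ([ m ] + [ n ])          ≡⟨ cong ([ l ] *_) ([]-+ m n) ⟩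
      [ l ] * [ m ℕ.+ n ]              ≡⟨ []-* l (m ℕ.+ n) ⟩
      [ l ℕ.* (m ℕ.+ n) ]              ≡⟨ cong [_] (ℕ.*-distribˡ-+ l m n) ⟩
      [ l ℕ.* m ℕ.+ l ℕ.* n ]          ≡⟨ []-+ (l ℕ.* m) (l ℕ.* n) ⟨
      [ l ℕ.* m ] + [ l ℕ.* n ]        ≡⟨ cong₂ _+_ ([]-* l m) ([]-* l n) ⟨
      [ l ] * [ m ] + [ l ] * [ n ]    ∎
    where open ≡-Reasoning

  +-comm : ∀ a b → a + b ≡ b + a
  +-comm a b = cong [_] (ℕ.+-comm (toℕ a) (toℕ b))

  *-comm : ∀ a b → a * b ≡ b * a
  *-comm a b = cong [_] (ℕ.*-comm (toℕ a) (toℕ b))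

  +-identityˡ : ∀ a → 0# + a ≡ a
  +-identityˡ a with n , refl ← []-surjective a = []-+ 0 n

  *-identityˡ : ∀ a → 1# * a ≡ a
  *-identityˡ a with n , refl ← []-surjective a =
    trans ([]-* 1 n) (cong [_] (ℕ.*-identityˡ n))

  -‿inverseˡ : ∀ a → - a + a ≡ 0#
  -‿inverseˡ a = ⊖-⊕ p 0# a

  commutativeRing : CommutativeRing 0ℓ 0ℓ
  commutativeRing = record
    { isCommutativeRing = record
      { isRing = record
        { +-isAbelianGroup = record
          { isGroup = record
            { isMonoid = record
              { isSemigroup = record
                { isMagma = record { isEquivalence = isEquivalence ; ∙-cong = cong₂ _+_ }
                ; assoc = +-assoc
                }
              ; identity = +-identityˡ , λ a → trans (+-comm a 0#) (+-identityˡ a)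
              }
            ; inverse = -‿inverseˡ , λ a → trans (+-comm a (- a)) (-‿inverseˡ a)
            ; ⁻¹-cong = cong -_
            }
          ; comm = +-comm
          }
        ; *-cong = cong₂ _*_
        ; *-assoc = *-assoc
        ; *-identity = *-identityˡ , λ a → trans (*-comm a 1#) (*-identityˡ a)
        ; distrib = *-distribˡ-+ , λ a b c →
            trans (*-comm (b + c) a)
              (trans (*-distribˡ-+ a b c) (cong₂ _+_ (*-comm a b) (*-comm a c)))
        }
      ; *-comm = *-comm
      }
    }

  open CommutativeRing commutativeRing public
    using (ring; +-abelianGroup; commutativeSemiring; +-identityʳ; -‿inverseʳ; zeroˡ; zeroʳ)
  open AbelianGroupProperties +-abelianGroup public
    using () renaming (⁻¹-∙-comm to -‿+-comm; ε⁻¹≈ε to -0≡0; ⁻¹-involutive to -‿involutive;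
      ∙-cancelʳ to +-cancelʳ; x∙y⁻¹≈ε⇒x≈y to a-b≡0⇒a≡b)
  open RingProperties ring public
    using (-‿distribˡ-*; -‿distribʳ-*)

  -- Coefficients (m , n) stand for the integers m − n.  They are kept reduced so
  -- that the solver can compare normal forms by refl.
  _⊝_ : ℕ → ℕ → ℕ × ℕ
  m ⊝ n = m ℕ.∸ n , n ℕ.∸ m

  -- With closed integer coefficients the solver sees that terms cancel even
  -- though p is a variable.
  Coefficient : RawRing 0ℓ 0ℓ
  Coefficient = record
    { Carrier = ℕ × ℕ
    ; _≈_ = _≡_
    ; _+_ = λ (a , b) (c , d) → (a ℕ.+ c) ⊝ (b ℕ.+ d)
    ; _*_ = λ (a , b) (c , d) → (a ℕ.* c ℕ.+ b ℕ.* d) ⊝ (a ℕ.* d ℕ.+ b ℕ.* c)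
    ; -_ = λ (a , b) → b , a
    ; 0# = 0 , 0
    ; 1# = 1 , 0
    }

  ⟦_⟧ᶜ : ℕ × ℕ → F
  ⟦ m , n ⟧ᶜ = [ m ] + - [ n ]

  private
    module S = SemiringSolver commutativeSemiring

  -- Adding `[ d ] + [ b ]` to both sides cancels the negatives. The semiring solver treats these as
  -- opaque variables; it serves here because the ring solver is itself built on this lemma.
  ⟦⟧ᶜ-cong : ∀ a b c d → a ℕ.+ d ≡ c ℕ.+ b → ⟦ a , b ⟧ᶜ ≡ ⟦ c , d ⟧ᶜ
  ⟦⟧ᶜ-cong a b c d eq = +-cancelʳ ([ d ] + [ b ]) _ _ (begin
    [ a ] + - [ b ] + ([ d ] + [ b ])
      ≡⟨ S.solve 4 (λ x y z w → x S.:+ y S.:+ (z S.:+ w) S.:= x S.:+ z S.:+ (y S.:+ w))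
           refl [ a ] (- [ b ]) [ d ] [ b ] ⟩
    [ a ] + [ d ] + (- [ b ] + [ b ])
      ≡⟨ cong₂ _+_ (trans ([]-+ a d) (trans (cong [_] eq) (sym ([]-+ c b))))
           (trans (-‿inverseˡ [ b ]) (sym (-‿inverseˡ [ d ]))) ⟩
    [ c ] + [ b ] + (- [ d ] + [ d ])
      ≡⟨ S.solve 4 (λ x y z w → x S.:+ y S.:+ (z S.:+ w) S.:= x S.:+ z S.:+ (w S.:+ y))
           refl [ c ] [ b ] (- [ d ]) [ d ] ⟩
    [ c ] + - [ d ] + ([ d ] + [ b ]) ∎)
    where open ≡-Reasoning

  -- The two cross sums to be compared are both the maximum of `m` and `n`.
  ⟦⟧ᶜ-⊝ : ∀ m n → ⟦ m ⊝ n ⟧ᶜ ≡ ⟦ m , n ⟧ᶜ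
  ⟦⟧ᶜ-⊝ m n = ⟦⟧ᶜ-cong (m ℕ.∸ n) (n ℕ.∸ m) m n (m∸n+n≡m+[n∸m] m n)

  coefficient-morphism : Coefficient -Raw-AlmostCommutative⟶ fromCommutativeRing commutativeRing
  coefficient-morphism = record
    { ⟦_⟧ = ⟦_⟧ᶜ
    ; +-homo = λ (a , b) (c , d) → begin
        ⟦ (a ℕ.+ c) ⊝ (b ℕ.+ d) ⟧ᶜ ≡⟨ ⟦⟧ᶜ-⊝ (a ℕ.+ c) (b ℕ.+ d) ⟩
        [ a ℕ.+ c ] + - [ b ℕ.+ d ]
          ≡⟨ cong₂ (λ u v → u + - v) ([]-+ a c) ([]-+ b d) ⟨
        ([ a ] + [ c ]) + - ([ b ] + [ d ])
          ≡⟨ cong (([ a ] + [ c ]) +_) (-‿+-comm [ b ] [ d ]) ⟨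
        ([ a ] + [ c ]) + (- [ b ] + - [ d ])
          ≡⟨ S.solve 4 (λ x y z w → (x S.:+ z) S.:+ (y S.:+ w) S.:= (x S.:+ y) S.:+ (z S.:+ w))
               refl [ a ] (- [ b ]) [ c ] (- [ d ]) ⟩
        ([ a ] + - [ b ]) + ([ c ] + - [ d ]) ∎
    ; *-homo = λ (a , b) (c , d) → begin
        ⟦ (a ℕ.* c ℕ.+ b ℕ.* d) ⊝ (a ℕ.* d ℕ.+ b ℕ.* c) ⟧ᶜ
          ≡⟨ ⟦⟧ᶜ-⊝ (a ℕ.* c ℕ.+ b ℕ.* d) (a ℕ.* d ℕ.+ b ℕ.* c) ⟩
        [ a ℕ.* c ℕ.+ b ℕ.* d ] + - [ a ℕ.* d ℕ.+ b ℕ.* c ]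
          ≡⟨ cong₂ (λ u v → u + - v) (dot a c b d) (dot a d b c) ⟩
        ([ a ] * [ c ] + [ b ] * [ d ]) + - ([ a ] * [ d ] + [ b ] * [ c ])
          ≡⟨ cong₂ _+_ (cong ([ a ] * [ c ] +_) (neg-neg [ b ] [ d ]))
               (trans (sym (-‿+-comm ([ a ] * [ d ]) ([ b ] * [ c ])))
                 (cong₂ _+_ (-‿distribʳ-* [ a ] [ d ]) (-‿distribˡ-* [ b ] [ c ]))) ⟩
        ([ a ] * [ c ] + - [ b ] * - [ d ]) + ([ a ] * - [ d ] + - [ b ] * [ c ])
          ≡⟨ S.solve 4 (λ x y z w → (x S.:* z S.:+ y S.:* w) S.:+ (x S.:* w S.:+ y S.:* z)
                 S.:= (x S.:+ y) S.:* (z S.:+ w)) refl [ a ] (- [ b ]) [ c ] (- [ d ]) ⟩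
        ([ a ] + - [ b ]) * ([ c ] + - [ d ]) ∎
    ; -‿homo = λ (a , b) → begin
        [ b ] + - [ a ]          ≡⟨ +-comm [ b ] (- [ a ]) ⟩
        - [ a ] + [ b ]          ≡⟨ cong (- [ a ] +_) (-‿involutive [ b ]) ⟨
        - [ a ] + - - [ b ]      ≡⟨ -‿+-comm [ a ] (- [ b ]) ⟩
        - ([ a ] + - [ b ])      ∎
    ; 0-homo = -‿inverseʳ 0#
    ; 1-homo = trans (cong (1# +_) -0≡0) (+-identityʳ 1#)
    }
    where
    open ≡-Reasoning
    dot : ∀ a c b d → [ a ℕ.* c ℕ.+ b ℕ.* d ] ≡ [ a ] * [ c ] + [ b ] * [ d ]
    dot a c b d = trans (sym ([]-+ (a ℕ.* c) (b ℕ.* d))) (sym (cong₂ _+_ ([]-* a c) ([]-* b d)))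
    neg-neg : ∀ x y → x * y ≡ - x * - y
    neg-neg x y = begin
      x * y          ≡⟨ cong (_* y) (-‿involutive x) ⟨
      - (- x) * y    ≡⟨ -‿distribˡ-* (- x) y ⟨
      - (- x * y)    ≡⟨ -‿distribʳ-* (- x) y ⟩
      - x * - y      ∎

  coefficient-≟ : ∀ x y → Maybe (⟦ x ⟧ᶜ ≡ ⟦ y ⟧ᶜ)
  coefficient-≟ (a , b) (c , d) = Maybe.map (⟦⟧ᶜ-cong a b c d) (dec⇒maybe (a ℕ.+ d ℕ.≟ c ℕ.+ b))

  module Solver = RingSolver Coefficient (fromCommutativeRing commutativeRing)
    coefficient-morphism coefficient-≟

  open Solver public using (solve; _:=_; _:+_; _:*_; :-_; Polynomial)

  -≡0 : ∀ {a} → - a ≡ 0# → a ≡ 0#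
  -≡0 {a} eq = trans (sym (-‿involutive a)) (trans (cong -_ eq) -0≡0)

  a-0≡a : ∀ a → a + - 0# ≡ a
  a-0≡a a = trans (cong (a +_) -0≡0) (+-identityʳ a)

  a-b+b≡a : ∀ a b → a + - b + b ≡ a
  a-b+b≡a = solve 2 (λ a b → a :+ :- b :+ b := a) refl

-- Inverses in the field with `p` elements.

module PrimeField (p : ℕ) .{{_ : NonZero p}} (p-prime : Prime p) where

  open ModularRing p public

  []-multiple : ∀ x → [ x ℕ.* p ] ≡ 0#
  []-multiple x = []-cong (trans (m*n%n≡0 x p) (sym (m*n%n≡0 0 p)))

  -- A Bézout identity between `p` and `toℕ a`, read modulo `p`, exhibits the coefficient of `toℕ a`
  -- as an inverse up to sign.
  inverse : ∀ a → a ≢ 0# → ∃ λ b → a * b ≡ 1#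
  inverse a a≢0 with coprime-Bézout (prime⇒coprime p-prime {{ℕ.≢-nonZero toℕ≢0}} (Fin.toℕ<n a))
    where
    toℕ≢0 : toℕ a ≢ 0
    toℕ≢0 eq = a≢0 (trans (sym ([]-toℕ a)) (cong [_] eq))
  -- Here 1 + y · a is a multiple of p, so the inverse is the negative of y.
  ... | Bézout.+- x y eq = - [ y ] , (begin
      a * - [ y ]
        ≡⟨ solve 3 (λ a y e → a :* (:- y) := e :+ :- (e :+ y :* a)) refl a [ y ] 1# ⟩
      1# + - (1# + [ y ] * a)                ≡⟨ cong (λ u → 1# + - u) vanishes ⟩
      1# + - 0#                              ≡⟨ cong (1# +_) -0≡0 ⟩
      1# + 0#                                ≡⟨ +-identityʳ 1# ⟩
      1#                                     ∎)
    where
    open ≡-Reasoning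
    vanishes : 1# + [ y ] * a ≡ 0#
    vanishes = begin
      1# + [ y ] * a                ≡⟨ cong (λ u → 1# + [ y ] * u) ([]-toℕ a) ⟨
      1# + [ y ] * [ toℕ a ]        ≡⟨ cong (1# +_) ([]-* y (toℕ a)) ⟩
      1# + [ y ℕ.* toℕ a ]          ≡⟨ []-+ 1 (y ℕ.* toℕ a) ⟩
      [ 1 ℕ.+ y ℕ.* toℕ a ]         ≡⟨ cong [_] eq ⟩
      [ x ℕ.* p ]                   ≡⟨ []-multiple x ⟩
      0#                            ∎
  ... | Bézout.-+ x y eq = [ y ] , (begin
      a * [ y ]                     ≡⟨ *-comm a [ y ] ⟩
      [ y ] * a                     ≡⟨ cong ([ y ] *_) ([]-toℕ a) ⟨
      [ y ] * [ toℕ a ]             ≡⟨ []-* y (toℕ a) ⟩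
      [ y ℕ.* toℕ a ]               ≡⟨ cong [_] eq ⟨
      [ 1 ℕ.+ x ℕ.* p ]             ≡⟨ []-+ 1 (x ℕ.* p) ⟨
      1# + [ x ℕ.* p ]              ≡⟨ cong (1# +_) ([]-multiple x) ⟩
      1# + 0#                       ≡⟨ +-identityʳ 1# ⟩
      1#                            ∎)
    where open ≡-Reasoning

  infix 9 _⁻¹

  -- Junk value: 0# ⁻¹ = 0#.
  _⁻¹ : F → F
  a ⁻¹ with a Fin.≟ 0#
  ... | yes _ = 0#
  ... | no a≢0 = proj₁ (inverse a a≢0)

  *-inverseʳ : ∀ {a} → a ≢ 0# → a * a ⁻¹ ≡ 1#
  *-inverseʳ {a} a≢0 with a Fin.≟ 0#
  ... | yes a≡0 = contradiction a≡0 a≢0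
  ... | no a≢0′ = proj₂ (inverse a a≢0′)

  *⁻¹-cancel : ∀ {a} → a ≢ 0# → ∀ b → a * (b * a ⁻¹) ≡ b
  *⁻¹-cancel {a} a≢0 b = begin
    a * (b * a ⁻¹)  ≡⟨ solve 3 (λ a b i → a :* (b :* i) := (a :* i) :* b) refl a b (a ⁻¹) ⟩
    a * a ⁻¹ * b    ≡⟨ cong (_* b) (*-inverseʳ a≢0) ⟩
    1# * b          ≡⟨ *-identityˡ b ⟩
    b               ∎
    where open ≡-Reasoning

  *-cancelˡ : ∀ {a} → a ≢ 0# → ∀ {b c} → a * b ≡ a * c → b ≡ c
  *-cancelˡ {a} a≢0 {b} {c} eq = begin
    b               ≡⟨ *⁻¹-cancel a≢0 b ⟨
    a * (b * a ⁻¹)  ≡⟨ *-assoc a b (a ⁻¹) ⟨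
    a * b * a ⁻¹    ≡⟨ cong (_* a ⁻¹) eq ⟩
    a * c * a ⁻¹    ≡⟨ *-assoc a c (a ⁻¹) ⟩
    a * (c * a ⁻¹)  ≡⟨ *⁻¹-cancel a≢0 c ⟩
    c               ∎
    where open ≡-Reasoning

  1≢0 : 1# ≢ 0#
  1≢0 eq = contradiction (ℕ.∣⇒≤ (ℕ.m%n≡0⇒n∣m 1 p (trans ([]-injective eq) (m*n%n≡0 0 p))))
    (ℕ.<⇒≱ (ℕ.nonTrivial⇒n>1 p {{prime⇒nonTrivial p-prime}}))

  module Odd (odd : 2 ∤ p) where

    2≢0 : 1# + 1# ≢ 0#
    2≢0 eq = odd (ℕ.∣-reflexive (ℕ.≤-antisym (ℕ.nonTrivial⇒n>1 p {{prime⇒nonTrivial p-prime}})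
      (ℕ.∣⇒≤ (ℕ.m%n≡0⇒n∣m 2 p (trans ([]-injective (trans (sym ([]-+ 1 1)) eq)) (m*n%n≡0 0 p))))))

    double≡0 : ∀ {a} → a + a ≡ 0# → a ≡ 0#
    double≡0 {a} eq = *-cancelˡ 2≢0 (begin
      (1# + 1#) * a    ≡⟨ solve 2 (λ e a → (e :+ e) :* a := e :* a :+ e :* a) refl 1# a ⟩
      1# * a + 1# * a  ≡⟨ cong₂ _+_ (*-identityˡ a) (*-identityˡ a) ⟩
      a + a            ≡⟨ eq ⟩
      0#               ≡⟨ zeroʳ (1# + 1#) ⟨
      (1# + 1#) * 0#   ∎)
      where open ≡-Reasoning

-- Labels of difference vectors and the involution `σ`.

module Construction (p : ℕ) .{{_ : NonZero p}} (p-prime : Prime p) (odd : 2 ∤ p) where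

  open PrimeField p p-prime
  open Odd odd

  infixl 6 _−_
  infix 8 ⁻_

  W : Set
  W = V p

  _−_ : W → W → W
  (a , b , c) − (a′ , b′ , c′) = a + - a′ , b + - b′ , c + - c′

  ⁻_ : W → W
  ⁻ (a , b , c) = - a , - b , - c

  origin : W
  origin = 0# , 0# , 0#

  second : W → F
  second (_ , b , _) = b

  third : W → F
  third (_ , _ , c) = c

  triple : ∀ {a a′ b b′ c c′ : F} → a ≡ a′ → b ≡ b′ → c ≡ c′ → (a , b , c) ≡ (a′ , b′ , c′)
  triple refl refl refl = refl

  shift : W ↔ W
  shift = ι p

  quad : W → F
  quad (a , b , c) = b * b + - (a * c + a * c) + - (b * c)

  :quad : ∀ {n} → Polynomial n → Polynomial n → Polynomial n → Polynomial n
  :quad a b c = b :* b :+ :- (a :* c :+ a :* c) :+ :- (b :* c)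

  σ : W → W
  σ (a , b , c) = a + b , - b , c

  flip : Sign → W → W
  flip plus  = λ v → v
  flip minus = σ

  -- Nonvanishing is recorded so that every label is attained by some vector, and irrelevantly so
  -- that labels agree as soon as their field entries do.
  data Label : Set where
    far  : (c : F) → .(c ≢ 0#) → F → Label
    near : (b : F) → .(b ≢ 0#) → Label
    here : F → Label

  _≟_ : DecidableEquality Label
  far c _ q ≟ far c′ _ q′ with c Fin.≟ c′ | q Fin.≟ q′
  ... | yes refl | yes refl = yes refl
  ... | no c≢c′  | _        = no λ { refl → c≢c′ refl }
  ... | _        | no q≢q′  = no λ { refl → q≢q′ refl }
  far _ _ _ ≟ near _ _ = no λ ()
  far _ _ _ ≟ here _   = no λ ()
  near b _ ≟ near b′ _ with b Fin.≟ b′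
  ... | yes refl = yes refl
  ... | no b≢b′  = no λ { refl → b≢b′ refl }
  near _ _ ≟ far _ _ _ = no λ ()
  near _ _ ≟ here _    = no λ ()
  here a ≟ here a′ with a Fin.≟ a′
  ... | yes refl = yes refl
  ... | no a≢a′  = no λ { refl → a≢a′ refl }
  here _ ≟ far _ _ _ = no λ ()
  here _ ≟ near _ _  = no λ ()

  label : W → Label
  label (a , b , c) with c Fin.≟ 0# | b Fin.≟ 0#
  ... | no c≢0 | _      = far c c≢0 (quad (a , b , c))
  ... | yes _  | no b≢0 = near b b≢0
  ... | yes _  | yes _  = here a

  label-far : ∀ {a b c} (c≢0 : c ≢ 0#) → label (a , b , c) ≡ far c c≢0 (quad (a , b , c))
  label-far {a} {b} {c} c≢0 with c Fin.≟ 0#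
  ... | yes c≡0 = contradiction c≡0 c≢0
  ... | no _    = refl

  label-near : ∀ {a b} (b≢0 : b ≢ 0#) → label (a , b , 0#) ≡ near b b≢0
  label-near {a} {b} b≢0 with 0# Fin.≟ 0# | b Fin.≟ 0#
  ... | no 0≢0 | _       = contradiction refl 0≢0
  ... | yes _  | yes b≡0 = contradiction b≡0 b≢0
  ... | yes _  | no _    = refl

  label-here : ∀ {a} → label (a , 0# , 0#) ≡ here a
  label-here with 0# Fin.≟ 0#
  ... | no 0≢0 = contradiction refl 0≢0
  ... | yes _  = refl

  -- Matching on a `View` not only splits the cases of `label` but also replaces vanishing
  -- coordinates by the term `0#`, the form that `label-near` and `label-here` expect.
  data View : W → Set where
    far  : ∀ a b c → c ≢ 0# → View (a , b , c)
    near : ∀ a b → b ≢ 0# → View (a , b , 0#)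
    here : ∀ a → View (a , 0# , 0#)

  view : ∀ v → View v
  view (a , b , c) with c Fin.≟ 0# | b Fin.≟ 0#
  ... | no c≢0   | _        = far a b c c≢0
  ... | yes refl | no b≢0   = near a b b≢0
  ... | yes refl | yes refl = here a

  label-far-cong : ∀ {a b a′ b′ c} → c ≢ 0# → quad (a , b , c) ≡ quad (a′ , b′ , c) →
    label (a , b , c) ≡ label (a′ , b′ , c)
  label-far-cong {c = c} c≢0 eq =
    trans (label-far c≢0) (trans (cong (far c c≢0) eq) (sym (label-far c≢0)))

  label-shift : ∀ v → label (to shift v) ≡ label v
  label-shift v with view v
  ... | far a b c c≢0 = label-far-cong c≢0
    (solve 3 (λ a b c → :quad (a :+ b) (b :+ c) c := :quad a b c) refl a b c)
  ... | near a b b≢0 = trans (cong (λ u → label (a + b , u , 0#)) (+-identityʳ b))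
    (trans (label-near b≢0) (sym (label-near b≢0)))
  ... | here a = cong₂ (λ u w → label (u , w , 0#)) (+-identityʳ a) (+-identityʳ 0#)

  -- Equivalently, `σ` conjugates `shift` into its inverse. Hence `σ` carries orbits of the powers
  -- of `shift` to such orbits, and labels taken after `σ` are again constant on them.
  σ-shift : ∀ v → to shift (σ (to shift v)) ≡ σ v
  σ-shift (a , b , c) = triple
    (solve 3 (λ a b c → a :+ b :+ (b :+ c) :+ :- (b :+ c) := a :+ b) refl a b c)
    (solve 2 (λ b c → :- (b :+ c) :+ c := :- b) refl b c) refl

  label-flip-shift : ∀ ε v → label (flip ε (to shift v)) ≡ label (flip ε v)
  label-flip-shift plus  v = label-shift v
  label-flip-shift minus v = trans (sym (label-shift (σ (to shift v)))) (cong label (σ-shift v))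

  flip-involutive : ∀ ε v → flip ε (flip ε v) ≡ v
  flip-involutive plus  v = refl
  flip-involutive minus (a , b , c) = triple
    (solve 2 (λ a b → a :+ b :+ :- b := a) refl a b) (-‿involutive b) refl

  flip-− : ∀ ε u v → flip ε (u − v) ≡ flip ε u − flip ε v
  flip-− plus  u v = refl
  flip-− minus (a , b , c) (a′ , b′ , c′) = triple
    (solve 4 (λ a b a′ b′ → a :+ :- a′ :+ (b :+ :- b′) := a :+ b :+ :- (a′ :+ b′)) refl a b a′ b′)
    (sym (-‿+-comm b (- b′))) refl

  flip-⁻ : ∀ ε v → flip ε (⁻ v) ≡ ⁻ flip ε v
  flip-⁻ plus  v = refl
  flip-⁻ minus (a , b , c) = triple (-‿+-comm a b) refl refl

  third-flip : ∀ ε v → third (flip ε v) ≡ third v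
  third-flip plus  v = refl
  third-flip minus v = refl

  label-flip : ∀ ε v → third v ≢ 0# → label (flip ε v) ≡ label v
  label-flip plus  v c≢0 = refl
  label-flip minus (a , b , c) c≢0 = label-far-cong c≢0
    (solve 3 (λ a b c → :quad (a :+ b) (:- b) c := :quad a b c) refl a b c)

  flip-axis : ∀ ε a c → flip ε (a , 0# , c) ≡ (a , 0# , c)
  flip-axis plus  a c = refl
  flip-axis minus a c = triple (+-identityʳ a) -0≡0 refl

  -- In the first case Q(a, 0, c) = - 2ac = q is solved for a, which is where 2 has to be
  -- invertible. Since `_⁻¹` is total, the irrelevant proof need not be consulted.
  rep : Label → W
  rep (far c _ q) = - (q * (c + c) ⁻¹) , 0# , c
  rep (near b _)  = 0# , b , 0#
  rep (here a)    = a , 0# , 0#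

  quad-axis : ∀ a c → quad (a , 0# , c) ≡ - ((c + c) * a)
  quad-axis a c = begin
    0# * 0# + - (a * c + a * c) + - (0# * c)
      ≡⟨ solve 3 (λ z a c → :quad a z c := z :* (z :+ :- c) :+ :- ((c :+ c) :* a)) refl 0# a c ⟩
    0# * (0# + - c) + - ((c + c) * a)  ≡⟨ cong (_+ - ((c + c) * a)) (zeroˡ (0# + - c)) ⟩
    0# + - ((c + c) * a)               ≡⟨ +-identityˡ _ ⟩
    - ((c + c) * a)                    ∎
    where open ≡-Reasoning

  double≢0 : ∀ {c} → c ≢ 0# → c + c ≢ 0#
  double≢0 c≢0 eq = c≢0 (double≡0 eq)

  label-rep : ∀ s → label (rep s) ≡ s
  label-rep (far c c≢0 q) = trans (label-far c≢0′) (cong (far c c≢0) (begin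
    quad (- (q * (c + c) ⁻¹) , 0# , c)   ≡⟨ quad-axis _ c ⟩
    - ((c + c) * - (q * (c + c) ⁻¹))
      ≡⟨ solve 2 (λ d x → :- (d :* (:- x)) := d :* x) refl (c + c) (q * (c + c) ⁻¹) ⟩
    (c + c) * (q * (c + c) ⁻¹)           ≡⟨ *⁻¹-cancel (double≢0 c≢0′) q ⟩
    q                                    ∎))
    where
    open ≡-Reasoning
    c≢0′ : c ≢ 0#
    c≢0′ = ¬-recompute c≢0
  label-rep (near b b≢0) = label-near (¬-recompute b≢0)
  label-rep (here a)     = label-here

  -- For fixed c ≠ 0 the value Q(a, 0, c) = - 2ac determines a, so a vector with second coordinate 0
  -- is already in normal form.
  rep-label-axis : ∀ a {c} → c ≢ 0# → rep (label (a , 0# , c)) ≡ (a , 0# , c)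
  rep-label-axis a {c} c≢0 = trans (cong rep (label-far c≢0)) (triple (begin
    - (quad (a , 0# , c) * (c + c) ⁻¹)   ≡⟨ cong (λ u → - (u * (c + c) ⁻¹)) (quad-axis a c) ⟩
    - (- ((c + c) * a) * (c + c) ⁻¹)
      ≡⟨ solve 3 (λ d a i → :- ((:- (d :* a)) :* i) := d :* (a :* i)) refl (c + c) a ((c + c) ⁻¹) ⟩
    (c + c) * (a * (c + c) ⁻¹)           ≡⟨ *⁻¹-cancel (double≢0 c≢0) a ⟩
    a                                    ∎) refl refl)
    where open ≡-Reasoning

  -- Normal forms under powers of `ι`.

  shift^ : ℕ → W ↔ W
  shift^ 0         = ↔-refl
  shift^ (ℕ.suc n) = ↔-trans (shift^ n) shift

  suc-* : ∀ n c → [ ℕ.suc n ] * c ≡ [ n ] * c + c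
  suc-* n c = begin
    [ ℕ.suc n ] * c        ≡⟨ cong (_* c) ([]-+ 1 n) ⟨
    (1# + [ n ]) * c       ≡⟨ solve 3 (λ e n c → (e :+ n) :* c := n :* c :+ e :* c) refl 1# [ n ] c ⟩
    [ n ] * c + 1# * c     ≡⟨ cong ([ n ] * c +_) (*-identityˡ c) ⟩
    [ n ] * c + c          ∎
    where open ≡-Reasoning

  +[0]* : ∀ b c → b + [ 0 ] * c ≡ b
  +[0]* b c = trans (cong (b +_) (zeroˡ c)) (+-identityʳ b)

  +suc-* : ∀ n b c → b + [ n ] * c + c ≡ b + [ ℕ.suc n ] * c
  +suc-* n b c = trans (+-assoc b ([ n ] * c) c) (cong (b +_) (sym (suc-* n c)))

  -- The first coordinate, which is quadratic in `n`, will be recovered from the invariance of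
  -- `quad`.
  shift^-second-third : ∀ n {a b c} → proj₂ (to (shift^ n) (a , b , c)) ≡ (b + [ n ] * c , c)
  shift^-second-third 0         {b = b} {c} = cong (_, c) (sym (+[0]* b c))
  shift^-second-third (ℕ.suc n) {a} {b} {c} = cong₂ _,_
    (trans (cong₂ _+_ (cong proj₁ ih) (cong proj₂ ih)) (+suc-* n b c)) (cong proj₂ ih)
    where
    ih : proj₂ (to (shift^ n) (a , b , c)) ≡ (b + [ n ] * c , c)
    ih = shift^-second-third n

  shift^-first : ∀ n a b → to (shift^ n) (a , b , 0#) ≡ (a + [ n ] * b , b , 0#)
  shift^-first 0         a b = triple (sym (+[0]* a b)) refl refl
  shift^-first (ℕ.suc n) a b = trans (cong (to shift) (shift^-first n a b))
    (triple (+suc-* n a b) (+-identityʳ b) refl)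

  label-flip-shift^ : ∀ n ε v → label (flip ε (to (shift^ n) v)) ≡ label (flip ε v)
  label-flip-shift^ 0         ε v = refl
  label-flip-shift^ (ℕ.suc n) ε v =
    trans (label-flip-shift ε (to (shift^ n) v)) (label-flip-shift^ n ε v)

  shift-− : ∀ u v → to shift (u − v) ≡ to shift u − to shift v
  shift-− (a , b , c) (a′ , b′ , c′) = triple (interchange a b a′ b′) (interchange b c b′ c′) refl
    where
    interchange : ∀ a b a′ b′ → (a + - a′) + (b + - b′) ≡ a + b + - (a′ + b′)
    interchange = solve 4
      (λ a b a′ b′ → a :+ :- a′ :+ (b :+ :- b′) := a :+ b :+ :- (a′ :+ b′)) refl

  shift^-− : ∀ n u v → to (shift^ n) (u − v) ≡ to (shift^ n) u − to (shift^ n) v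
  shift^-− 0         u v = refl
  shift^-− (ℕ.suc n) u v = trans (cong (to shift) (shift^-− n u v))
    (shift-− (to (shift^ n) u) (to (shift^ n) v))

  cancelling-multiple : ∀ b {c} → c ≢ 0# → ∃ λ n → b + [ n ] * c ≡ 0#
  cancelling-multiple b {c} c≢0 = toℕ k , (begin
    b + [ toℕ k ] * c        ≡⟨ cong (λ u → b + u * c) ([]-toℕ k) ⟩
    b + - (b * c ⁻¹) * c
      ≡⟨ solve 3 (λ b i c → b :+ (:- (b :* i)) :* c := b :+ :- (c :* (b :* i))) refl b (c ⁻¹) c ⟩
    b + - (c * (b * c ⁻¹))   ≡⟨ cong (λ u → b + - u) (*⁻¹-cancel c≢0 b) ⟩
    b + - b                  ≡⟨ -‿inverseʳ b ⟩
    0#                       ∎)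
    where
    open ≡-Reasoning
    k : F
    k = - (b * c ⁻¹)

  -- The choice of `n` makes the second coordinate of `w` vanish, so `w` is the representative of
  -- its own label, and that label has not changed along the powers of `shift`.
  normalise-far : ∀ n a b c → c ≢ 0# → b + [ n ] * c ≡ 0# →
    to (shift^ n) (a , b , c) ≡ rep (label (a , b , c))
  normalise-far n a b c c≢0 eq = begin
    w                               ≡⟨ w≡axis ⟩
    (proj₁ w , 0# , c)              ≡⟨ rep-label-axis (proj₁ w) c≢0 ⟨
    rep (label (proj₁ w , 0# , c))  ≡⟨ cong (λ u → rep (label u)) w≡axis ⟨
    rep (label w)                   ≡⟨ cong rep (label-flip-shift^ n plus (a , b , c)) ⟩
    rep (label (a , b , c))         ∎
    where
    open ≡-Reasoning
    w : W
    w = to (shift^ n) (a , b , c)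
    w≡axis : w ≡ (proj₁ w , 0# , c)
    w≡axis = cong (proj₁ w ,_) (trans (shift^-second-third n) (cong (_, c) eq))

  normalise-near : ∀ n a b → b ≢ 0# → a + [ n ] * b ≡ 0# →
    to (shift^ n) (a , b , 0#) ≡ rep (label (a , b , 0#))
  normalise-near n a b b≢0 eq =
    trans (shift^-first n a b) (trans (triple eq refl refl) (sym (cong rep (label-near b≢0))))

  -- This makes `label` a complete invariant: vectors with equal labels are moved to the same
  -- representative.
  normalise : ∀ v → ∃ λ n → to (shift^ n) v ≡ rep (label v)
  normalise v = go (view v)
    where
    go : ∀ {v} → View v → ∃ λ n → to (shift^ n) v ≡ rep (label v)
    go (far a b c c≢0) =
      let n , eq = cancelling-multiple b c≢0 in n , normalise-far n a b c c≢0 eq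
    go (near a b b≢0) =
      let n , eq = cancelling-multiple a b≢0 in n , normalise-near n a b b≢0 eq
    go (here a) = 0 , sym (cong rep label-here)

  -- Converse labels.

  star : Label → Label
  star (far c c≢0 q) = far (- c) (λ eq → c≢0 (-≡0 eq)) q
  star (near b b≢0)  = near (- b) (λ eq → b≢0 (-≡0 eq))
  star (here a)      = here (- a)

  label-⁻ : ∀ v → label (⁻ v) ≡ star (label v)
  label-⁻ v = go (view v)
    where
    go : ∀ {v} → View v → label (⁻ v) ≡ star (label v)
    go (far a b c c≢0) = trans (label-far {a = - a} {b = - b} (λ eq → c≢0 (-≡0 eq)))
      (trans (cong (far (- c) (λ eq → c≢0 (-≡0 eq)))
        (solve 3 (λ a b c → :quad (:- a) (:- b) (:- c) := :quad a b c) refl a b c))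
        (sym (cong star (label-far {a = a} {b = b} c≢0))))
    go (near a b b≢0) = trans (cong (λ u → label (- a , - b , u)) -0≡0)
      (trans (label-near {a = - a} (λ eq → b≢0 (-≡0 eq))) (sym (cong star (label-near {a = a} b≢0))))
    go (here a) = trans (cong₂ (λ u w → label (- a , u , w)) -0≡0 -0≡0)
      (trans (label-here {a = - a}) (sym (cong star (label-here {a = a}))))

  label-star-star : ∀ v → star (star (label v)) ≡ label v
  label-star-star v = trans (cong star (sym (label-⁻ v)))
    (trans (sym (label-⁻ (⁻ v))) (cong label (⁻-involutive v)))
    where
    ⁻-involutive : ∀ v → ⁻ ⁻ v ≡ v
    ⁻-involutive (a , b , c) = triple (-‿involutive a) (-‿involutive b) (-‿involutive c)

  -- Inherited from double negation of vectors, because each label is that of its representative.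
  star-involutive : ∀ s → star (star s) ≡ s
  star-involutive s =
    subst (λ s → star (star s) ≡ s) (label-rep s) (label-star-star (rep s))

  −-swap : ∀ u v → u − v ≡ ⁻ (v − u)
  −-swap (a , b , c) (a′ , b′ , c′) = triple (swap a a′) (swap b b′) (swap c c′)
    where
    swap : ∀ a b → a + - b ≡ - (b + - a)
    swap = solve 2 (λ a b → a :+ :- b := :- (b :+ :- a)) refl

  −-origin : ∀ v → v − origin ≡ v
  −-origin (a , b , c) = triple (a-0≡a a) (a-0≡a b) (a-0≡a c)

  −-self : ∀ v → v − v ≡ origin
  −-self (a , b , c) = triple (-‿inverseʳ a) (-‿inverseʳ b) (-‿inverseʳ c)

  −≡origin : ∀ u v → u − v ≡ origin → u ≡ v
  −≡origin (a , b , c) (a′ , b′ , c′) eq = triple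
    (a-b≡0⇒a≡b a a′ (cong proj₁ eq))
    (a-b≡0⇒a≡b b b′ (cong (λ v → proj₁ (proj₂ v)) eq))
    (a-b≡0⇒a≡b c c′ (cong third eq))

  −-cancelʳ : ∀ u v w → u − w − (v − w) ≡ u − v
  −-cancelʳ (a , b , c) (a′ , b′ , c′) (a″ , b″ , c″) =
    triple (cancel a a′ a″) (cancel b b′ b″) (cancel c c′ c″)
    where
    cancel : ∀ a b e → a + - e + - (b + - e) ≡ a + - b
    cancel = solve 3 (λ a b e → a :+ :- e :+ :- (b :+ :- e) := a :+ :- b) refl

  -- Counting the points with two prescribed labels.

  enumeration : Fin (p ℕ.* (p ℕ.* p)) ↔ W
  enumeration = ↔-trans Fin.*↔× (↔-refl ×-↔ Fin.*↔×)

  Labelling : Set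
  Labelling = W → Label

  infix 4 _∼_
  -- A single bijection has to match both labellings at once; the counts then agree for all pairs of
  -- labels simultaneously.
  record _∼_ (l m : Labelling × Labelling) : Set where
    constructor _,_
    field
      bijection : W ↔ W
      agreement : ∀ z → proj₁ l z ≡ proj₁ m (to bijection z) × proj₂ l z ≡ proj₂ m (to bijection z)

  ∼-trans : ∀ {l m n} → l ∼ m → m ∼ n → l ∼ n
  ∼-trans (π , eq) (π′ , eq′) = ↔-trans π π′ , λ z →
    trans (proj₁ (eq z)) (proj₁ (eq′ (to π z))) , trans (proj₂ (eq z)) (proj₂ (eq′ (to π z)))

  count : Labelling × Labelling → Label → Label → ℕ
  count (f , g) s t =
    length (filter (λ z → (f z ≟ s) ×-dec (g z ≟ t)) (elements enumeration))

  count-∼ : ∀ {l m} → l ∼ m → ∀ s t → count l s t ≡ count m s t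
  count-∼ (π , eq) s t = length-filter-↔ enumeration _ _ π λ z → mk⇔
    (λ (f≡s , g≡t) → trans (sym (proj₁ (eq z))) f≡s , trans (sym (proj₂ (eq z))) g≡t)
    (λ (f≡s , g≡t) → trans (proj₁ (eq z)) f≡s , trans (proj₂ (eq z)) g≡t)

  -- The labels of z seen from origin and from d, when these points lie in fibres
  -- with signs ε and ε′.
  pair : Sign → Sign → W → Labelling × Labelling
  pair ε ε′ d = (λ z → label (flip ε z)) , λ z → label (flip ε′ (z − d))

  pair-shift^ : ∀ n ε ε′ d → pair ε ε′ d ∼ pair ε ε′ (to (shift^ n) d)
  pair-shift^ n ε ε′ d = shift^ n , λ z →
    sym (label-flip-shift^ n ε z) ,
    trans (sym (label-flip-shift^ n ε′ (z − d)))
      (cong (λ w → label (flip ε′ w)) (shift^-− n z d))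

  pair-flip : ∀ ε d → pair ε ε d ∼ pair plus plus (flip ε d)
  pair-flip ε d =
    mk↔ₛ′ (flip ε) (flip ε) (flip-involutive ε) (flip-involutive ε) ,
    λ z → refl , cong label (flip-− ε z d)

  module Fibrewise (ε ε′ : Sign) (a c : F) (c≢0 : c ≢ 0#) where

    -- The fibre of `origin` receives `ε` and the fibre of `d` receives `ε′`. As `c` is nonzero,
    -- these two demands never collide.
    sign : F → Sign
    sign e with e Fin.≟ 0# | e Fin.≟ c
    ... | yes _ | _     = ε
    ... | no _  | yes _ = ε′
    ... | no _  | no _  = plus

    sign-0 : sign 0# ≡ ε
    sign-0 with 0# Fin.≟ 0#
    ... | yes _  = refl
    ... | no 0≢0 = contradiction refl 0≢0

    sign-c : sign c ≡ ε′
    sign-c with c Fin.≟ 0# | c Fin.≟ c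
    ... | yes c≡0 | _      = contradiction c≡0 c≢0
    ... | no _    | yes _  = refl
    ... | no _    | no c≢c = contradiction refl c≢c

    φ : W → W
    φ z = flip (sign (third z)) z

    -- A flip stays inside its fibre, so the same sign is chosen the second time.
    φ-involutive : ∀ z → φ (φ z) ≡ z
    φ-involutive z = trans
      (cong (λ e → flip (sign e) (φ z)) (third-flip (sign (third z)) z))
      (flip-involutive (sign (third z)) z)

    d : W
    d = a , 0# , c

    -- In the fibre of `origin` the sign is `ε` by choice; any other point has nonzero third
    -- coordinate, where no flip affects the label.
    labelˡ : ∀ z → label (flip ε z) ≡ label (φ z)
    labelˡ z = go (third z Fin.≟ 0#)
      where
      go : Dec (third z ≡ 0#) → label (flip ε z) ≡ label (φ z)
      go (yes z₃≡0) = cong (λ η → label (flip η z)) (sym (trans (cong sign z₃≡0) sign-0))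
      go (no z₃≢0)  = trans (label-flip ε z z₃≢0) (sym (label-flip (sign (third z)) z z₃≢0))

    flip-−d : ∀ η z → flip η (z − d) ≡ flip η z − d
    flip-−d η z = trans (flip-− η z d) (cong (flip η z −_) (flip-axis η a c))

    -- The same argument for the fibre of `d`, after subtracting `d`: flips are additive and fix
    -- `d`, whose second coordinate is 0.
    labelʳ : ∀ z → label (flip ε′ (z − d)) ≡ label (φ z − d)
    labelʳ z = trans (go (third z Fin.≟ c)) (cong label (flip-−d (sign (third z)) z))
      where
      go : Dec (third z ≡ c) →
        label (flip ε′ (z − d)) ≡ label (flip (sign (third z)) (z − d))
      go (yes z₃≡c) =
        cong (λ η → label (flip η (z − d))) (sym (trans (cong sign z₃≡c) sign-c))
      go (no z₃≢c) = trans (label-flip ε′ (z − d) z₃-c≢0)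
        (sym (label-flip (sign (third z)) (z − d) z₃-c≢0))
        where
        z₃-c≢0 : third (z − d) ≢ 0#
        z₃-c≢0 eq = z₃≢c (a-b≡0⇒a≡b (third z) c eq)

    pair-fibrewise : pair ε ε′ d ∼ pair plus plus d
    pair-fibrewise =
      mk↔ₛ′ φ φ φ-involutive φ-involutive , λ z → labelˡ z , labelʳ z

  -- The signs and `d` survive on the right only through the label of the pair. So this one
  -- bijection shows both that intersection numbers are well defined and that they do not depend on
  -- the signs.
  pair-rep : ∀ ε ε′ d → (third d ≡ 0# → ε ≡ ε′) →
    pair ε ε′ d ∼ pair plus plus (rep (label (flip ε d)))
  pair-rep ε ε′ d ε≡ε′ = go (third d Fin.≟ 0#)
    where
    pair-normalise : ∀ ε ε′ v → pair ε ε′ v ∼ pair ε ε′ (rep (label v))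
    pair-normalise ε ε′ v = subst (λ w → pair ε ε′ v ∼ pair ε ε′ w) (proj₂ (normalise v))
      (pair-shift^ (proj₁ (normalise v)) ε ε′ v)

    go : Dec (third d ≡ 0#) → pair ε ε′ d ∼ pair plus plus (rep (label (flip ε d)))
    go (yes d₃≡0) = subst (λ η → pair ε η d ∼ pair plus plus (rep (label (flip ε d)))) (ε≡ε′ d₃≡0)
      (∼-trans (pair-flip ε d) (pair-normalise plus plus (flip ε d)))
    -- Normalising comes first, as fibrewise reflection needs second coordinate 0. The substitutions
    -- identify the label of `flip ε d` with that of `d` and expose it as a `far` label, whose
    -- representative has the required shape.
    go (no d₃≢0) = ∼-trans (pair-normalise ε ε′ d)
      (subst (λ s → pair ε ε′ (rep (label d)) ∼ pair plus plus (rep s)) (sym (label-flip ε d d₃≢0))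
        (subst (λ s → pair ε ε′ (rep s) ∼ pair plus plus (rep s))
          (sym (label-far {proj₁ d} {proj₁ (proj₂ d)} d₃≢0))
          (Fibrewise.pair-fibrewise ε ε′ (proj₁ (rep (far (third d) d₃≢0 (quad d)))) (third d) d₃≢0)))

  -- The scheme belonging to a choice of sign for each fibre.

  module Twist (twist : F → Sign) where

    rel : W → W → Label
    rel x y = label (flip (twist (third x)) (y − x))

    pair-rel : ∀ x y → (rel x , rel y) ∼ pair (twist (third x)) (twist (third y)) (y − x)
    pair-rel x y = τ p (⁻ x) , λ z →
      refl , cong (λ w → label (flip (twist (third y)) w)) (sym (−-cancelʳ z y x))

    twist-cong : ∀ x y → third (y − x) ≡ 0# → twist (third x) ≡ twist (third y)
    twist-cong x y eq = cong twist (sym (a-b≡0⇒a≡b (third y) (third x) eq))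

    -- The sign is now taken from `y` instead of `x`. This is harmless: within one fibre the signs
    -- coincide, and between different fibres flips leave labels alone.
    rel-swap : ∀ x y → rel y x ≡ star (rel x y)
    rel-swap x y = begin
      label (flip ε′ (x − y))      ≡⟨ cong (λ w → label (flip ε′ w)) (−-swap x y) ⟩
      label (flip ε′ (⁻ (y − x)))  ≡⟨ cong label (flip-⁻ ε′ (y − x)) ⟩
      label (⁻ flip ε′ (y − x))    ≡⟨ label-⁻ (flip ε′ (y − x)) ⟩
      star (label (flip ε′ (y − x))) ≡⟨ cong star (go (third (y − x) Fin.≟ 0#)) ⟩
      star (rel x y)               ∎
      where
      open ≡-Reasoning
      ε ε′ : Sign
      ε = twist (third x)
      ε′ = twist (third y)
      go : Dec (third (y − x) ≡ 0#) → label (flip ε′ (y − x)) ≡ label (flip ε (y − x))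
      go (yes eq) = cong (λ η → label (flip η (y − x))) (sym (twist-cong x y eq))
      go (no ≢0)  = trans (label-flip ε′ (y − x) ≢0) (sym (label-flip ε (y − x) ≢0))

    label≡here⇒origin : ∀ v → label v ≡ here 0# → v ≡ origin
    label≡here⇒origin v eq = go (view v) eq
      where
      go : ∀ {v} → View v → label v ≡ here 0# → v ≡ origin
      go (far a b c c≢0) eq with () ← trans (sym (label-far c≢0)) eq
      go (near a b b≢0)  eq with () ← trans (sym (label-near b≢0)) eq
      go (here a)        eq with refl ← trans (sym label-here) eq = refl

    flip-origin : ∀ ε → flip ε origin ≡ origin
    flip-origin ε = flip-axis ε 0# 0#

    scheme : AssociationScheme W
    scheme = record
      { size = p ℕ.* (p ℕ.* p)
      ; enum = enumeration
      ; point = origin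
      ; S = Label
      ; _≟_ = _≟_
      ; rel = rel
      -- Flipping the representative in advance undoes the flip contained in `rel`.
      ; rel-surjective = λ s → origin , flip (twist 0#) (rep s) , (begin
          label (flip (twist 0#) (flip (twist 0#) (rep s) − origin))
            ≡⟨ cong (λ w → label (flip (twist 0#) w)) (−-origin (flip (twist 0#) (rep s))) ⟩
          label (flip (twist 0#) (flip (twist 0#) (rep s)))
            ≡⟨ cong label (flip-involutive (twist 0#) (rep s)) ⟩
          label (rep s)  ≡⟨ label-rep s ⟩
          s ∎)
      ; 1ₓ = here 0#
      ; rel-1ₓ = λ x y → mk⇔
          (λ eq → sym (−≡origin y x (begin
            y − x   ≡⟨ flip-involutive (twist (third x)) (y − x) ⟨
            flip (twist (third x)) (flip (twist (third x)) (y − x))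
              ≡⟨ cong (flip (twist (third x))) (label≡here⇒origin _ eq) ⟩
            flip (twist (third x)) origin  ≡⟨ flip-origin (twist (third x)) ⟩
            origin ∎)))
          (λ { refl → trans (cong label (trans (cong (flip (twist (third x))) (−-self x))
            (flip-origin (twist (third x))))) label-here })
      ; _* = star
      ; rel-* = λ s x y → mk⇔
          (λ eq → trans (rel-swap x y) (trans (cong star eq) (star-involutive s)))
          (λ eq → trans (rel-swap y x) (cong star eq))
      -- The count is taken in the untwisted situation, at `origin` and `rep u`, so its definition
      -- does not involve `twist`.
      ; c = λ s t u → count (pair plus plus (rep u)) s (star t)
      -- Translation by - x turns the labels seen from `x` and `y` into a `pair`; `pair-rep` then
      -- moves it to the representative of the label of (x, y), which is `u`.
      ; c-≡ = λ { s t u x y refl → count-∼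
          (∼-trans (pair-rel x y)
            (pair-rep (twist (third x)) (twist (third y)) (y − x) (twist-cong x y)))
          s (star t) }
      }
      where open ≡-Reasoning

  -- The untwisted scheme consists of the orbitals of `G p`.

  shift^∈G : ∀ n → shift^ n ∈ Closure (Generator p)
  shift^∈G 0         = id∈
  shift^∈G (ℕ.suc n) = ∘∈ (shift^∈G n) (gen ι∈)

  -- Translations leave differences unchanged and `ι` applies `shift` to them. For an inverse, the
  -- claim is used at the preimages.
  label-−-invariant : ∀ {g} → g ∈ Closure (Generator p) →
    ∀ x y → label (to g y − to g x) ≡ label (y − x)
  label-−-invariant (gen (τ∈ (t₁ , t₂ , t₃))) (a , b , c) (a′ , b′ , c′) =
    cong label (triple (cancel a′ a t₁) (cancel b′ b t₂) (cancel c′ c t₃))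
    where
    cancel : ∀ a b t → a + t + - (b + t) ≡ a + - b
    cancel = solve 3 (λ a b t → a :+ t :+ :- (b :+ t) := a :+ :- b) refl
  label-−-invariant (gen ι∈) x y = trans (cong label (sym (shift-− y x))) (label-shift (y − x))
  label-−-invariant (resp eq g∈) x y =
    trans (cong₂ (λ u v → label (v − u)) (sym (eq x)) (sym (eq y))) (label-−-invariant g∈ x y)
  label-−-invariant id∈ x y = refl
  label-−-invariant (∘∈ {g} {h} g∈ h∈) x y =
    trans (label-−-invariant h∈ (to g x) (to g y)) (label-−-invariant g∈ x y)
  label-−-invariant (inv∈ {g} g∈) x y = trans
    (sym (label-−-invariant g∈ (from g x) (from g y)))
    (cong₂ (λ u v → label (v − u)) (strictlyInverseˡ g x) (strictlyInverseˡ g y))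

  shift^-origin : ∀ n → to (shift^ n) origin ≡ origin
  shift^-origin n = trans (shift^-first n 0# 0#)
    (triple (trans (+-identityˡ ([ n ] * 0#)) (zeroʳ [ n ])) refl refl)

  τ-− : ∀ x y → to (τ p y) (x − y) ≡ x
  τ-− (a , b , c) (a′ , b′ , c′) = triple (a-b+b≡a a a′) (a-b+b≡a b b′) (a-b+b≡a c c′)

  τ-origin : ∀ y → to (τ p y) origin ≡ y
  τ-origin (a , b , c) = triple (+-identityˡ a) (+-identityˡ b) (+-identityˡ c)

  -- The group element translates x to `origin`, brings the difference to the common representative,
  -- returns from there to the difference y′ - x′, and translates `origin` to x′.
  label-−⇒orbital : ∀ x y x′ y′ → label (y − x) ≡ label (y′ − x′) →
    SameOrbital (G p) (x , y) (x′ , y′)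
  label-−⇒orbital x y x′ y′ eq = orbital (normalise (y − x)) (normalise (y′ − x′))
    where
    orbital : (∃ λ n → to (shift^ n) (y − x) ≡ rep (label (y − x))) →
      (∃ λ n → to (shift^ n) (y′ − x′) ≡ rep (label (y′ − x′))) →
      SameOrbital (G p) (x , y) (x′ , y′)
    orbital (m , eqₘ) (n , eqₙ) =
      ↔-trans (τ p (⁻ x)) (↔-trans (shift^ m) (↔-trans (↔-sym (shift^ n)) (τ p x′))) ,
      ∘∈ (gen (τ∈ (⁻ x))) (∘∈ (shift^∈G m) (∘∈ (inv∈ (shift^∈G n)) (gen (τ∈ x′)))) ,
      trans (cong (to (τ p x′)) (trans
        (cong (from (shift^ n)) (trans (cong (to (shift^ m)) (−-self x))
          (trans (shift^-origin m) (sym (shift^-origin n)))))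
        (strictlyInverseʳ (shift^ n) origin))) (τ-origin x′) ,
      trans (cong (to (τ p x′)) (trans
        (cong (from (shift^ n)) (trans eqₘ (trans (cong rep eq) (sym eqₙ))))
        (strictlyInverseʳ (shift^ n) (y′ − x′)))) (τ-− y′ x′)

  module Untwisted = Twist (λ _ → plus)

  schurian-scheme : AssociationScheme W
  schurian-scheme = Untwisted.scheme

  schurian-orbitals : schurian-scheme ≡ℛ G p
  schurian-orbitals x y x′ y′ = mk⇔ (label-−⇒orbital x y x′ y′)
    (λ { (g , g∈ , refl , refl) → sym (label-−-invariant g∈ x y) })

  -- The scheme twisted in fibre 0 is not Schurian.

  reflect₀ : F → Sign
  reflect₀ e with e Fin.≟ 0#
  ... | yes _ = minus
  ... | no _  = plus

  reflect₀-0 : reflect₀ 0# ≡ minus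
  reflect₀-0 with 0# Fin.≟ 0#
  ... | yes _  = refl
  ... | no 0≢0 = contradiction refl 0≢0

  reflect₀-≢0 : ∀ {e} → e ≢ 0# → reflect₀ e ≡ plus
  reflect₀-≢0 {e} e≢0 with e Fin.≟ 0#
  ... | yes e≡0 = contradiction e≡0 e≢0
  ... | no _    = refl

  module Twisted = Twist reflect₀

  -- The value of `secondᴸ` on `far` and those of `quadᴸ` on `near` and `here` are junk; the others
  -- are invariants shared by all vectors with the given label.
  thirdᴸ secondᴸ quadᴸ : Label → F
  thirdᴸ (far c _ _) = c
  thirdᴸ (near _ _)  = 0#
  thirdᴸ (here _)    = 0#
  secondᴸ (far _ _ _) = 0#
  secondᴸ (near b _)  = b
  secondᴸ (here _)    = 0#
  quadᴸ (far _ _ q) = q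
  quadᴸ (near _ _)  = 0#
  quadᴸ (here _)    = 0#

  third-label : ∀ v → thirdᴸ (label v) ≡ third v
  third-label v = go (view v)
    where
    go : ∀ {v} → View v → thirdᴸ (label v) ≡ third v
    go (far a b c c≢0) = cong thirdᴸ (label-far {a} {b} c≢0)
    go (near a b b≢0)  = cong thirdᴸ (label-near {a} b≢0)
    go (here a)        = cong thirdᴸ (label-here {a})

  second-label : ∀ v → third v ≡ 0# → secondᴸ (label v) ≡ second v
  second-label v = go (view v)
    where
    go : ∀ {v} → View v → third v ≡ 0# → secondᴸ (label v) ≡ second v
    go (far a b c c≢0) c≡0 = contradiction c≡0 c≢0
    go (near a b b≢0)  _ = cong secondᴸ (label-near {a} b≢0)
    go (here a)        _ = cong secondᴸ (label-here {a})

  quad-label : ∀ v → third v ≢ 0# → quadᴸ (label v) ≡ quad v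
  quad-label (a , b , c) c≢0 = cong quadᴸ (label-far {a} {b} c≢0)

  mixed-difference : W → W → W → W → F
  mixed-difference u u′ v v′ =
    quad (v − u) + - quad (v − u′) + - quad (v′ − u) + quad (v′ − u′)

  double : F → F
  double a = a + a

  -- All four vectors have the same third coordinate, so the terms of `quad` other than the square
  -- are linear in the remaining coordinates and cancel; the square leaves minus twice the product.
  mixed-difference-≡ : ∀ u u′ v v′ → third u ≡ third u′ → third v ≡ third v′ →
    mixed-difference u u′ v v′ ≡ - double (second (u′ − u) * second (v′ − v))
  mixed-difference-≡ (a , b , c) (a′ , b′ , .c) (x , y , z) (x′ , y′ , .z) refl refl =
    solve 10 (λ a b c a′ b′ x y z x′ y′ →
      let w = z :+ :- c
          e = (b′ :+ :- b) :* (y′ :+ :- y)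
      in :quad (x :+ :- a) (y :+ :- b) w :+ :- :quad (x :+ :- a′) (y :+ :- b′) w
         :+ :- :quad (x′ :+ :- a) (y′ :+ :- b) w :+ :quad (x′ :+ :- a′) (y′ :+ :- b′) w
         := :- (e :+ e))
      refl a b c a′ b′ x y z x′ y′

  non-schurian : ¬ Schurian Twisted.scheme
  non-schurian (H , transitive , orbitals) = 1≢0 (begin
    1#                                     ≡⟨ *-identityˡ 1# ⟨
    1# * 1#                                ≡⟨ cong₂ _*_ (a-0≡a 1#) (a-0≡a 1#) ⟨
    second (u′ − u) * second (v′ − v)      ≡⟨ double≡0 (double≡0 quadruple) ⟩
    0#                                     ∎)
    where
    open ≡-Reasoning
    -- Each of the fibres 0 and 1 contributes two points whose second coordinates differ by 1, so
    -- `product` equals 1.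
    u u′ v v′ : W
    u  = origin
    u′ = 0# , 1# , 0#
    v  = 0# , 0# , 1#
    v′ = 0# , 1# , 1#

    g : W ↔ W
    g = proj₁ (transitive u v)

    h : W → W
    h = to g

    hu≡v : h u ≡ v
    hu≡v = proj₂ (proj₂ (transitive u v))

    preserves : ∀ x y → Twisted.rel (h x) (h y) ≡ Twisted.rel x y
    preserves x y = sym (Equivalence.from (orbitals x y (h x) (h y))
      (g , proj₁ (proj₂ (transitive u v)) , refl , refl))

    third-preserved : ∀ x y → third (h y − h x) ≡ third (y − x)
    third-preserved x y = begin
      third (h y − h x)                     ≡⟨ third-flip (reflect₀ (third (h x))) (h y − h x) ⟨
      third (flip (reflect₀ (third (h x))) (h y − h x)) ≡⟨ third-label _ ⟨
      thirdᴸ (Twisted.rel (h x) (h y))      ≡⟨ cong thirdᴸ (preserves x y) ⟩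
      thirdᴸ (Twisted.rel x y)              ≡⟨ third-label _ ⟩
      third (flip (reflect₀ (third x)) (y − x)) ≡⟨ third-flip (reflect₀ (third x)) (y − x) ⟩
      third (y − x)                         ∎

    quad-preserved : ∀ x y → third (y − x) ≢ 0# → quad (h y − h x) ≡ quad (y − x)
    quad-preserved x y ≢0 = begin
      quad (h y − h x)               ≡⟨ quad-label (h y − h x) ≢0′ ⟨
      quadᴸ (label (h y − h x))
        ≡⟨ cong quadᴸ (label-flip (reflect₀ (third (h x))) (h y − h x) ≢0′) ⟨
      quadᴸ (Twisted.rel (h x) (h y))  ≡⟨ cong quadᴸ (preserves x y) ⟩
      quadᴸ (Twisted.rel x y)          ≡⟨ cong quadᴸ (label-flip (reflect₀ (third x)) (y − x) ≢0) ⟩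
      quadᴸ (label (y − x))            ≡⟨ quad-label (y − x) ≢0 ⟩
      quad (y − x)                     ∎
      where
      ≢0′ : third (h y − h x) ≢ 0#
      ≢0′ eq = ≢0 (trans (sym (third-preserved x y)) eq)

    -- Within a fibre the flips must be kept; their signs depend on the fibres before and after `h`,
    -- and this is what detects the reflected fibre.
    second-preserved : ∀ x y → third (y − x) ≡ 0# →
      second (flip (reflect₀ (third (h x))) (h y − h x)) ≡ second (flip (reflect₀ (third x)) (y − x))
    second-preserved x y ≡0 = begin
      second (flip (reflect₀ (third (h x))) (h y − h x))
        ≡⟨ second-label _ (trans (third-flip (reflect₀ (third (h x))) (h y − h x))
             (trans (third-preserved x y) ≡0)) ⟨
      secondᴸ (Twisted.rel (h x) (h y))  ≡⟨ cong secondᴸ (preserves x y) ⟩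
      secondᴸ (Twisted.rel x y)
        ≡⟨ second-label _ (trans (third-flip (reflect₀ (third x)) (y − x)) ≡0) ⟩
      second (flip (reflect₀ (third x)) (y − x)) ∎

    third-hu : third (h u) ≡ 1#
    third-hu = cong third hu≡v

    third-hv : third (h v) ≡ 1# + 1#
    third-hv = begin
      third (h v)                          ≡⟨ a-b+b≡a (third (h v)) (third (h u)) ⟨
      third (h v) + - third (h u) + third (h u)
        ≡⟨ cong₂ _+_ (trans (third-preserved u v) (a-0≡a 1#)) third-hu ⟩
      1# + 1#                              ∎

    -- h carries the reflected fibre 0 to the fibre 1 and the fibre 1 to the fibre 2.
    second-hu : second (h u′ − h u) ≡ - second (u′ − u)
    second-hu = trans
      (cong (λ ε → second (flip ε (h u′ − h u)))
        (sym (reflect₀-≢0 (λ eq → 1≢0 (trans (sym third-hu) eq)))))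
      (trans (second-preserved u u′ (a-0≡a 0#))
        (cong (λ ε → second (flip ε (u′ − u))) reflect₀-0))

    second-hv : second (h v′ − h v) ≡ second (v′ − v)
    second-hv = trans
      (cong (λ ε → second (flip ε (h v′ − h v)))
        (sym (reflect₀-≢0 (λ eq → 2≢0 (trans (sym third-hv) eq)))))
      (trans (second-preserved v v′ (-‿inverseʳ 1#))
        (cong (λ ε → second (flip ε (v′ − v))) (reflect₀-≢0 1≢0)))

    1-0≢0 : 1# + - 0# ≢ 0#
    1-0≢0 eq = 1≢0 (trans (sym (a-0≡a 1#)) eq)

    mixed-difference-preserved :
      mixed-difference (h u) (h u′) (h v) (h v′) ≡ mixed-difference u u′ v v′
    mixed-difference-preserved = cong₂ _+_ (cong₂ _+_ (cong₂ _+_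
      (quad-preserved u v 1-0≢0) (cong -_ (quad-preserved u′ v 1-0≢0)))
      (cong -_ (quad-preserved u v′ 1-0≢0))) (quad-preserved u′ v′ 1-0≢0)

    same-fibre : ∀ x y → third (y − x) ≡ 0# → third (h x) ≡ third (h y)
    same-fibre x y eq = sym (a-b≡0⇒a≡b (third (h y)) (third (h x)) (trans (third-preserved x y) eq))

    product : F
    product = second (u′ − u) * second (v′ − v)

    -- The mixed difference is - 2 times `product` before `h` and, one factor having changed sign, +
    -- 2 times `product` after it. Equality of the two gives 4 · `product` = 0.
    quadruple : double (double product) ≡ 0#
    quadruple = begin
      double (double product)
        ≡⟨ cong (double product +_) (-‿involutive (double product)) ⟨
      double product + - (- double product)
        ≡⟨ cong (λ w → double product + - w) (mixed-difference-≡ u u′ v v′ refl refl) ⟨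
      double product + - mixed-difference u u′ v v′
        ≡⟨ cong (λ w → double product + - w) mixed-difference-preserved ⟨
      double product + - mixed-difference (h u) (h u′) (h v) (h v′)
        ≡⟨ cong (λ w → double product + - w) (mixed-difference-≡ (h u) (h u′) (h v) (h v′)
             (same-fibre u u′ (a-0≡a 0#)) (same-fibre v v′ (-‿inverseʳ 1#))) ⟩
      double product + - (- double (second (h u′ − h u) * second (h v′ − h v)))
        ≡⟨ cong₂ (λ s t → double product + - (- double (s * t))) second-hu second-hv ⟩
      double product + - (- double (- second (u′ − u) * second (v′ − v)))
        ≡⟨ solve 2 (λ s t → s :* t :+ s :* t :+ :- (:- ((:- s) :* t :+ (:- s) :* t)) 
               := s :* t :+ :- (s :* t))
             refl (second (u′ − u)) (second (v′ − v)) ⟩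
      product + - product                  ≡⟨ -‿inverseʳ product ⟩
      0#                                   ∎

  same-intersection-numbers : SameIntersectionNumbers Twisted.scheme schurian-scheme
  -- Both schemes have the same labels and, as `c` does not involve the twist, definitionally the
  -- same intersection numbers.
  same-intersection-numbers = record { bij = ↔-refl ; c-≡ = λ r s t → refl }

theorem4p3 : (p : ℕ) → .{{_ : NonZero p}} → Prime p → 2 ∤ p →
    Σ (AssociationScheme (V p)) λ 𝒯 → (𝒯 ≡ℛ G p) ×
    Σ Set λ X → Σ (AssociationScheme X) λ 𝒮 →
    ¬ Schurian 𝒮 × SameIntersectionNumbers 𝒮 𝒯
theorem4p3 p p-prime odd =
  schurian-scheme , schurian-orbitals , V p , Twisted.scheme , non-schurian , same-intersection-numbers
  where open Construction p p-prime odd
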